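{- There are unsatisfiable $k$-CNF formulas $F$ with $\mathrm{occ}_F(x) \cdot \mathrm{occ}_F(\bar{x}) \in O(3.01^k)$ for all variables $x$.
   Context: A CNF formula is a set of clauses, each a set of literals (no repeated literal, no variable together with its negation); a $k$-CNF formula has all clauses of size exactly $k$. For a literal $u$, $\mathrm{occ}_F(u)$ denotes the number of clauses of $F$ containing $u$. -}

module Defs where

open import Data.Nat using (ℕ; _*_; _^_; _≤_)
open import Data.Bool using (Bool; true; false; not)
open import Data.Product using (_×_; _,_; proj₁; proj₂; Σ; ∃)
open import Data.List using (List; length; filter)
open import Data.List.Relation.Unary.All using (All)
open import Data.List.Relation.Unary.Any using (Any)
open import Data.List.Relation.Unary.AllPairs using (AllPairs)
open import Data.List.Relation.Binary.Permutation.Propositional using (_↭_)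
open import Relation.Binary.PropositionalEquality using (_≡_)
open import Relation.Nullary using (¬_)
import Data.Nat.Properties as ℕP
import Data.Bool.Properties as BP
open import Data.Product.Properties using (≡-dec)
import Data.List.Membership.DecPropositional as DecMem

Var : Set
Var = ℕ

Literal : Set
Literal = Var × Bool

var : Literal → Var
var = proj₁

pos : Var → Literal
pos x = (x , true)

neg : Var → Literal
neg x = (x , false)

_≟L_ : (u v : Literal) → Relation.Nullary.Dec (u ≡ v)
_≟L_ = ≡-dec ℕP._≟_ BP._≟_

open DecMem _≟L_ using (_∈?_; _∈_)

Clause : Set
Clause = List Literal

CNF : Set
CNF = List Clause

-- Well-formed clause: no repeated literal, no variable together with its
-- negation (i.e. any two list entries have distinct variables).
WellFormedClause : Clause → Set
WellFormedClause C = AllPairs (λ u v → ¬ (var u ≡ var v)) C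

-- A CNF formula is a set of well-formed clauses: distinct entries of the
-- list represent distinct sets of literals.
WellFormedCNF : CNF → Set
WellFormedCNF F = All WellFormedClause F × AllPairs (λ C D → ¬ (C ↭ D)) F

IsKCNF : ℕ → CNF → Set
IsKCNF k F = WellFormedCNF F × All (λ C → length C ≡ k) F

Assignment : Set
Assignment = Var → Bool

SatLit : Assignment → Literal → Set
SatLit α (x , b) = α x ≡ b

SatClause : Assignment → Clause → Set
SatClause α C = Any (SatLit α) C

Satisfies : Assignment → CNF → Set
Satisfies α F = All (SatClause α) F

Unsatisfiable : CNF → Set
Unsatisfiable F = (α : Assignment) → ¬ Satisfies α F

occ : CNF → Literal → ℕ
occ F u = length (filter (u ∈?_) F)

{-# OPTIONS --safe #-}

-- Write k = R + 39 j with 1 ≤ R ≤ 39. Over n = 52287 j variables take positive clauses of size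
-- a = 39 j and negative clauses of size b = 8 j. An assignment in which about 5/6 of the variables
-- are false falsifies at least a (5/6)^a fraction of all positive a-clauses; any other assignment
-- falsifies at least a (100/601)^b fraction of all negative b-clauses. Greedy set cover over the
-- 2^n assignments therefore finds O(n (6/5)^a) positive and O(n 6.01^b) negative clauses that are
-- jointly unsatisfiable. Each clause is then padded to size k by the complete formula over fresh
-- variables of its own. An original variable gets an occurrence product of order
-- n² (6/5)^a 6.01^b 2^(k-b), a fresh one at most 4^(k-b); the ratio b / a = 8/39 puts both below
-- 3.01^k, the first with exponential slack that absorbs n².

module Submission where

open import Defs
open import Data.Bool using (Bool; true; false; not; T?)
open import Data.Bool.ListAction using (all)
open import Data.Fin using (Fin; toℕ)
open import Data.Fin.Properties using (toℕ<n; toℕ-injective)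
open import Data.List using (List; []; _∷_; _++_; map; length; filter; filterᵇ; allFin)
import Data.List.Membership.DecPropositional as DecMembership
open import Data.List.Membership.Propositional using (_∈_; _∉_)
open import Data.List.Membership.Propositional.Properties using (∈-++⁺ˡ; ∈-++⁺ʳ; ∈-map⁺; ∈-filter⁺)
open import Data.List.Properties using (length-++; length-++-≤ˡ; length-map; length-tabulate; length-filter; filter-++; filter-none)
open import Data.List.Relation.Binary.Permutation.Propositional using (_↭_; ↭-sym)
open import Data.List.Relation.Binary.Permutation.Propositional.Properties using (∈-resp-↭)
open import Data.List.Relation.Unary.All as All using (All; []; _∷_)
import Data.List.Relation.Unary.All.Properties as AllP
open import Data.List.Relation.Unary.AllPairs as AllPairs using (AllPairs; []; _∷_)
import Data.List.Relation.Unary.AllPairs.Properties as AllPairsP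
open import Data.List.Relation.Unary.Any using (Any; here; there)
open import Data.List.Relation.Unary.Unique.Propositional.Properties using (allFin⁺)
open import Data.Nat
open import Data.Nat.Combinatorics using (nCk+nC[k+1]≡[n+1]C[k+1]) renaming (_C_ to _choose_)
open import Data.Nat.DivMod using (m≡m%n+[m/n]*n; m%n<n; m/n*n≤m)
open import Data.Nat.ListAction using (sum)
open import Data.Nat.Properties
open import Data.Nat.Tactic.RingSolver using (solve-∀)
open import Data.Product using (Σ; _×_; _,_)
open import Data.Sum using (_⊎_; inj₁; inj₂)
open import Data.Unit using (tt)
open import Data.Vec using (Vec; []; _∷_; lookup; tabulate)
open import Data.Vec.Properties using (lookup∘tabulate)
open import Relation.Binary.PropositionalEquality
open import Relation.Nullary using (Dec; ¬_; yes; no; contradiction)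
open import Relation.Nullary.Decidable using (_×-dec_)

private variable
  A B : Set

-- Counting and averaging

ind : Bool → ℕ
ind true  = 1
ind false = 0

count : (A → Bool) → List A → ℕ
count g xs = sum (map (λ x → ind (g x)) xs)

count-++ : (g : A → Bool) (xs ys : List A) → count g (xs ++ ys) ≡ count g xs + count g ys
count-++ g []       ys = refl
count-++ g (x ∷ xs) ys = trans (cong (ind (g x) +_) (count-++ g xs ys)) (sym (+-assoc (ind (g x)) _ _))

count-map : (g : B → Bool) (f : A → B) (xs : List A) → count g (map f xs) ≡ count (λ x → g (f x)) xs
count-map g f []       = refl
count-map g f (x ∷ xs) = cong (ind (g (f x)) +_) (count-map g f xs)

count-false : (xs : List A) → count (λ _ → false) xs ≡ 0
count-false []       = refl
count-false (x ∷ xs) = count-false xs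

count+count-not : (g : A → Bool) (xs : List A) → count g xs + count (λ x → not (g x)) xs ≡ length xs
count+count-not g []       = refl
count+count-not g (x ∷ xs) with g x
... | true  = cong suc (count+count-not g xs)
... | false = trans (+-suc _ _) (cong suc (count+count-not g xs))

length-filterᵇ : (g : A → Bool) (xs : List A) → length (filterᵇ g xs) ≡ count g xs
length-filterᵇ g []       = refl
length-filterᵇ g (x ∷ xs) with g x
... | true  = cong suc (length-filterᵇ g xs)
... | false = length-filterᵇ g xs

sum-map-+ : (f g : A → ℕ) (xs : List A) → sum (map (λ x → f x + g x) xs) ≡ sum (map f xs) + sum (map g xs)
sum-map-+ f g []       = refl
sum-map-+ f g (x ∷ xs) = trans (cong (f x + g x +_) (sum-map-+ f g xs)) (lemma (f x) (g x) _ _)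
  where
  lemma : ∀ a b c d → a + b + (c + d) ≡ a + c + (b + d)
  lemma = solve-∀

sum-map-0 : (xs : List A) → sum (map (λ _ → 0) xs) ≡ 0
sum-map-0 []       = refl
sum-map-0 (x ∷ xs) = sum-map-0 xs

double-count : (r : A → B → Bool) (xs : List A) (ys : List B) →
  sum (map (λ y → count (λ x → r x y) xs) ys) ≡ sum (map (λ x → count (r x) ys) xs)
double-count r []       ys = sum-map-0 ys
double-count r (x ∷ xs) ys =
  trans (sum-map-+ (λ y → ind (r x y)) _ ys) (cong (count (r x) ys +_) (double-count r xs ys))

sum-map-bound : (f : A → ℕ) (p c : ℕ) {xs : List A} → All (λ x → p * f x ≤ c) xs →
  p * sum (map f xs) ≤ length xs * c
sum-map-bound f p c []                 = ≤-reflexive (*-zeroʳ p)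
sum-map-bound f p c {x ∷ xs} (h ∷ hs) =
  ≤-trans (≤-reflexive (*-distribˡ-+ p (f x) _)) (+-mono-≤ h (sum-map-bound f p c hs))

-- The witness minimises `f`, because every comparison keeps the smaller value. Multiplying by the
-- length instead of dividing the sum keeps the average within `ℕ`.
below-average : (f : A → ℕ) (x : A) (xs : List A) →
  Σ A λ y → y ∈ (x ∷ xs) × length (x ∷ xs) * f y ≤ sum (map f (x ∷ xs))
below-average f x []        = x , here refl , ≤-refl
below-average f x (x′ ∷ xs) with below-average f x′ xs
... | y , y∈ , h with ≤-total (f x) (f y)
...   | inj₁ le = x , here refl , +-monoʳ-≤ (f x) (≤-trans (*-monoʳ-≤ (length (x′ ∷ xs)) le) h)
...   | inj₂ ge = y , there y∈ , +-mono-≤ ge h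

-- Greedy covering

hit⇒miss : ∀ p q h m l → h + m ≡ l → q * l ≤ p * h → p * m ≤ (p ∸ q) * l
hit⇒miss p q h m l refl le = begin
  p * m                        ≡⟨ m+n∸m≡n (p * h) (p * m) ⟨
  p * h + p * m ∸ p * h        ≤⟨ ∸-monoʳ-≤ (p * h + p * m) le ⟩
  p * h + p * m ∸ q * (h + m)  ≡⟨ cong (_∸ q * (h + m)) (*-distribˡ-+ p h m) ⟨
  p * (h + m) ∸ q * (h + m)    ≡⟨ *-distribʳ-∸ (h + m) p q ⟨
  (p ∸ q) * (h + m)            ∎
  where open ≤-Reasoning

-- Each round takes a `z` that misses the fewest remaining elements, which leaves at most a fraction
-- `1 - q / p` of them. The strict inequality says that fewer than one element is left after `m`
-- rounds.
greedy-cover : (r : A → B → Bool) (p q : ℕ) .{{_ : NonZero p}} (Y : List B) → 0 < length Y →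
  ∀ m (xs : List A) →
  All (λ x → q * length Y ≤ p * count (r x) Y) xs →
  length xs * (p ∸ q) ^ m < p ^ m →
  Σ (List B) λ zs → length zs ≤ m × All (_∈ Y) zs ×
    (∀ {x} → x ∈ xs → Any (λ z → r x z ≡ true) zs)
greedy-cover r p q Y 0<Y m [] hs lt = [] , z≤n , [] , λ ()
-- With no rounds left the inequality would read `length (x ∷ xs) * 1 < 1`.
greedy-cover r p q Y 0<Y zero (x ∷ xs) hs (s≤s ())
greedy-cover {A = A} r p q Y@(y ∷ ys) 0<Y (suc m) xs@(_ ∷ _) hs lt
  with below-average (λ z → count (λ x → not (r x z)) xs) y ys
... | z , z∈ , few with greedy-cover r p q Y 0<Y m rest rest-hs rest-lt
  where
  rest : List A
  rest = filterᵇ (λ x → not (r x z)) xs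

  rest-hs : All (λ x → q * length Y ≤ p * count (r x) Y) rest
  rest-hs = AllP.filter⁺ (λ x → T? (not (r x z))) hs

  -- Misses are double counted: `z` is missed by at most the average over `Y`, while each element of
  -- `xs` misses at most a fraction `1 - q / p` of `Y`. The factor `length Y` then cancels.
  few-missed : p * length rest ≤ length xs * (p ∸ q)
  few-missed = *-cancelˡ-≤ (length Y) (begin
    length Y * (p * length rest)
      ≡⟨ cong (λ l → length Y * (p * l)) (length-filterᵇ _ xs) ⟩
    length Y * (p * count (λ x → not (r x z)) xs)
      ≡⟨ swap (length Y) p _ ⟩
    p * (length Y * count (λ x → not (r x z)) xs)
      ≤⟨ *-monoʳ-≤ p few ⟩
    p * sum (map (λ z → count (λ x → not (r x z)) xs) Y)
      ≡⟨ cong (p *_) (double-count (λ x z → not (r x z)) xs Y) ⟩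
    p * sum (map (λ x → count (λ z → not (r x z)) Y) xs)
      ≤⟨ sum-map-bound _ p ((p ∸ q) * length Y)
           (All.map (λ {x} h → hit⇒miss p q _ _ _ (count+count-not (r x) Y) h) hs) ⟩
    length xs * ((p ∸ q) * length Y)
      ≡⟨ swap′ (length xs) (p ∸ q) (length Y) ⟩
    length Y * (length xs * (p ∸ q)) ∎)
    where
    open ≤-Reasoning
    swap : ∀ a b c → a * (b * c) ≡ b * (a * c)
    swap = solve-∀
    swap′ : ∀ a b c → a * (b * c) ≡ c * (a * b)
    swap′ = solve-∀

  rest-lt : length rest * (p ∸ q) ^ m < p ^ m
  rest-lt = *-cancelˡ-< p _ _ (begin-strict
    p * (length rest * (p ∸ q) ^ m)     ≡⟨ *-assoc p _ _ ⟨
    p * length rest * (p ∸ q) ^ m       ≤⟨ *-monoˡ-≤ ((p ∸ q) ^ m) few-missed ⟩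
    length xs * (p ∸ q) * (p ∸ q) ^ m   ≡⟨ *-assoc (length xs) (p ∸ q) ((p ∸ q) ^ m) ⟩
    length xs * (p ∸ q) ^ suc m         <⟨ lt ⟩
    p ^ suc m                           ∎)
    where open ≤-Reasoning
... | zs , len , zs∈ , cover = z ∷ zs , s≤s len , z∈ ∷ zs∈ , cover′
  where
  keep : ∀ {x} xs → x ∈ xs → r x z ≡ false → x ∈ filterᵇ (λ x → not (r x z)) xs
  keep (x′ ∷ xs) (here refl) e rewrite e = here refl
  keep (x′ ∷ xs) (there i)   e with r x′ z
  ... | true  = keep xs i e
  ... | false = there (keep xs i e)

  cover′ : ∀ {x} → x ∈ xs → Any (λ z → r x z ≡ true) (z ∷ zs)
  cover′ {x} i with r x z in eq
  ... | true  = here eq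
  ... | false = there (cover (keep xs i eq))

-- Bernoulli's inequality `(1 + d / a) ^ r ≥ 1 + r d / a`, multiplied through by `a ^ (r + 1)`.
bernoulli : ∀ a d r → a ^ r * (a + r * d) ≤ a * (a + d) ^ r
bernoulli a d zero    = ≤-reflexive (lemma a)
  where
  lemma : ∀ a → 1 * (a + 0) ≡ a * 1
  lemma = solve-∀
bernoulli a d (suc r) = begin
  a * a ^ r * (a + (d + r * d))   ≡⟨ lemma₁ a (a ^ r) d (r * d) ⟩
  a ^ r * (a * (a + r * d) + a * d)
    ≤⟨ *-monoʳ-≤ (a ^ r) (+-monoʳ-≤ (a * (a + r * d))
         (≤-trans (*-monoˡ-≤ d (m≤m+n a (r * d))) (≤-reflexive (*-comm (a + r * d) d)))) ⟩
  a ^ r * (a * (a + r * d) + d * (a + r * d)) ≡⟨ lemma₂ (a ^ r) a d (a + r * d) ⟩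
  a ^ r * (a + r * d) * (a + d)   ≤⟨ *-monoˡ-≤ (a + d) (bernoulli a d r) ⟩
  a * (a + d) ^ r * (a + d)       ≡⟨ lemma₃ a ((a + d) ^ r) (a + d) ⟩
  a * ((a + d) * (a + d) ^ r)     ∎
  where
  open ≤-Reasoning
  lemma₁ : ∀ a x d y → a * x * (a + (d + y)) ≡ x * (a * (a + y) + a * d)
  lemma₁ = solve-∀
  lemma₂ : ∀ x a d y → x * (a * y + d * y) ≡ x * y * (a + d)
  lemma₂ = solve-∀
  lemma₃ : ∀ a x y → a * x * y ≡ a * (y * x)
  lemma₃ = solve-∀

-- Apply `bernoulli` with `a = p ∸ q` and `d = q`: since `r * q ≥ p ≥ a`, its left side is at least
-- `a ^ r * (a + a)`, and one factor `a` cancels.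
halving : ∀ p q r .{{_ : NonZero r}} → q ≤ p → p ≤ r * q → 2 * (p ∸ q) ^ r ≤ p ^ r
halving p q r@(suc _) q≤p p≤rq with p ∸ q in eq
... | zero      = z≤n
... | a@(suc _) = *-cancelˡ-≤ a (begin
  a * (2 * a ^ r)        ≡⟨ lemma a (a ^ r) ⟩
  a ^ r * (a + a)        ≤⟨ *-monoʳ-≤ (a ^ r) (+-monoʳ-≤ a (≤-trans (≤-trans (≤-reflexive (sym eq)) (m∸n≤m p q)) p≤rq)) ⟩
  a ^ r * (a + r * q)    ≤⟨ bernoulli a q r ⟩
  a * (a + q) ^ r        ≡⟨ cong (λ z → a * z ^ r) (trans (cong (_+ q) (sym eq)) (m∸n+n≡m q≤p)) ⟩
  a * p ^ r              ∎)
  where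
  open ≤-Reasoning
  lemma : ∀ a x → a * (2 * x) ≡ x * (a + a)
  lemma = solve-∀

^-distribʳ-* : ∀ m n o → (m * n) ^ o ≡ m ^ o * n ^ o
^-distribʳ-* m n zero    = refl
^-distribʳ-* m n (suc o) = trans (cong (m * n *_) (^-distribʳ-* m n o)) ([m*n]*[o*p]≡[m*o]*[n*p] m n (m ^ o) (n ^ o))

-- Every block of `r` rounds halves what is left, and `suc n` halvings bring `2 ^ n` below one.
enough-rounds : ∀ p q r n .{{_ : NonZero r}} .{{_ : NonZero p}} → q ≤ p → p ≤ r * q →
  2 ^ n * (p ∸ q) ^ (r * suc n) < p ^ (r * suc n)
enough-rounds p q r n q≤p p≤rq with (p ∸ q) ^ (r * suc n) in eq
-- The power vanishes when `p` equals `q`; it is split off because a strict inequality survives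
-- multiplication only by a nonzero factor.
... | zero  = <-≤-trans (s≤s (≤-reflexive (*-zeroʳ (2 ^ n)))) (m^n>0 p (r * suc n))
... | x@(suc _) = begin-strict
  2 ^ n * x                         <⟨ *-monoˡ-< x (^-monoʳ-< 2 (s≤s (s≤s z≤n)) (n<1+n n)) ⟩
  2 ^ suc n * x                     ≡⟨ cong (2 ^ suc n *_) (trans (sym eq) (sym (^-*-assoc (p ∸ q) r (suc n)))) ⟩
  2 ^ suc n * ((p ∸ q) ^ r) ^ suc n ≡⟨ ^-distribʳ-* 2 ((p ∸ q) ^ r) (suc n) ⟨
  (2 * (p ∸ q) ^ r) ^ suc n         ≤⟨ ^-monoˡ-≤ (suc n) (halving p q r q≤p p≤rq) ⟩
  (p ^ r) ^ suc n                   ≡⟨ ^-*-assoc p r (suc n) ⟩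
  p ^ (r * suc n)                   ∎
  where open ≤-Reasoning

-- Sublists of fixed length

combinations : ℕ → List A → List (List A)
combinations zero    xs       = [] ∷ []
combinations (suc k) []       = []
combinations (suc k) (x ∷ xs) = map (x ∷_) (combinations k xs) ++ combinations (suc k) xs

length-combinations : ∀ k (xs : List A) → length (combinations k xs) ≡ length xs choose k
length-combinations zero    xs       = refl
length-combinations (suc k) []       = refl
length-combinations (suc k) (x ∷ xs) = begin
  length (map (x ∷_) (combinations k xs) ++ combinations (suc k) xs)
    ≡⟨ length-++ (map (x ∷_) (combinations k xs)) ⟩
  length (map (x ∷_) (combinations k xs)) + length (combinations (suc k) xs)
    ≡⟨ cong₂ _+_ (trans (length-map _ (combinations k xs)) (length-combinations k xs)) (length-combinations (suc k) xs) ⟩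
  length xs choose k + length xs choose suc k
    ≡⟨ nCk+nC[k+1]≡[n+1]C[k+1] (length xs) k ⟩
  length (x ∷ xs) choose suc k ∎
  where open ≡-Reasoning

-- Sublists starting with `x` count only if `g x` holds. In that case the two halves add up by
-- Pascal's rule; otherwise the first half contributes nothing.
count-all-combinations : (g : A → Bool) (k : ℕ) (xs : List A) →
  count (all g) (combinations k xs) ≡ count g xs choose k
count-all-combinations g zero    xs       = refl
count-all-combinations g (suc k) []       = refl
count-all-combinations g (suc k) (x ∷ xs)
  rewrite count-++ (all g) (map (x ∷_) (combinations k xs)) (combinations (suc k) xs)
        | count-map (all g) (x ∷_) (combinations k xs)
        | count-all-combinations g (suc k) xs
  with g x
... | true  = trans (cong (_+ count g xs choose suc k) (count-all-combinations g k xs)) (nCk+nC[k+1]≡[n+1]C[k+1] (count g xs) k)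
... | false = cong (_+ count g xs choose suc k) (count-false (combinations k xs))

length-∈-combinations : ∀ k (xs : List A) → All (λ ys → length ys ≡ k) (combinations k xs)
length-∈-combinations zero    xs       = refl ∷ []
length-∈-combinations (suc k) []       = []
length-∈-combinations (suc k) (x ∷ xs) =
  AllP.++⁺ (AllP.map⁺ (All.map (cong suc) (length-∈-combinations k xs))) (length-∈-combinations (suc k) xs)

All-combinations : {P : A → Set} → ∀ k {xs} → All P xs → All (All P) (combinations k xs)
All-combinations zero    ps       = [] ∷ []
All-combinations (suc k) []       = []
All-combinations (suc k) (p ∷ ps) =
  AllP.++⁺ (AllP.map⁺ (All.map (p ∷_) (All-combinations k ps))) (All-combinations (suc k) ps)

AllPairs-combinations : {R : A → A → Set} → ∀ k {xs} → AllPairs R xs → All (AllPairs R) (combinations k xs)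
AllPairs-combinations zero    rs       = [] ∷ []
AllPairs-combinations (suc k) []       = []
AllPairs-combinations (suc k) (r ∷ rs) =
  AllP.++⁺ (AllP.map⁺ (All.zipWith (λ (h , t) → h ∷ t) (All-combinations k r , AllPairs-combinations k rs)))
    (AllPairs-combinations (suc k) rs)

combinations-nonempty : ∀ k (xs : List A) → k ≤ length xs → 0 < length (combinations k xs)
combinations-nonempty zero    xs       _        = s≤s z≤n
combinations-nonempty (suc k) (x ∷ xs) (s≤s le) = begin-strict
  0                                                     <⟨ combinations-nonempty k xs le ⟩
  length (combinations k xs)                            ≡⟨ length-map (x ∷_) (combinations k xs) ⟨
  length (map (x ∷_) (combinations k xs))               ≤⟨ length-++-≤ˡ (map (x ∷_) (combinations k xs)) ⟩
  length (combinations (suc k) (x ∷ xs))                ∎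
  where open ≤-Reasoning

-- Ratios of binomial coefficients

absorption : ∀ m k → suc k * (suc m choose suc k) ≡ suc m * (m choose k)
absorption zero    zero    = refl
absorption zero    (suc k) = *-zeroʳ (suc (suc k))
absorption (suc m) zero    = begin
  1 * (suc (suc m) choose 1)            ≡⟨ cong (1 *_) (nCk+nC[k+1]≡[n+1]C[k+1] (suc m) 0) ⟨
  1 * (1 + suc m choose 1)              ≡⟨ *-distribˡ-+ 1 1 (suc m choose 1) ⟩
  1 + 1 * (suc m choose 1)              ≡⟨ cong suc (absorption m 0) ⟩
  suc (suc m * 1)                  ∎
  where open ≡-Reasoning
absorption (suc m) (suc k) = begin
  suc (suc k) * (suc (suc m) choose suc (suc k))
    ≡⟨ cong (suc (suc k) *_) (nCk+nC[k+1]≡[n+1]C[k+1] (suc m) (suc k)) ⟨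
  suc (suc k) * (u + suc m choose suc (suc k))
    ≡⟨ *-distribˡ-+ (suc (suc k)) u _ ⟩
  u + suc k * u + suc (suc k) * (suc m choose suc (suc k))
    ≡⟨ cong₂ (λ y z → u + y + z) (absorption m k) (absorption m (suc k)) ⟩
  u + suc m * (m choose k) + suc m * (m choose suc k)
    ≡⟨ +-assoc u _ _ ⟩
  u + (suc m * (m choose k) + suc m * (m choose suc k))
    ≡⟨ cong (u +_) (*-distribˡ-+ (suc m) (m choose k) (m choose suc k)) ⟨
  u + suc m * (m choose k + m choose suc k)
    ≡⟨ cong (λ z → u + suc m * z) (nCk+nC[k+1]≡[n+1]C[k+1] m k) ⟩
  u + suc m * u ∎
  where
  open ≡-Reasoning
  u = suc m choose suc k

-- The quotient of the two coefficients is the product of `(t + i) / (n + i)` for `i` from 1 to `k`.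
-- Each factor is at least `q / p`, because `q * n ≤ p * t` and `q * i ≤ p * i`; `absorption` peels
-- off one factor at a time.
choose-ratio : ∀ p q t n → q ≤ p → q * n ≤ p * t → ∀ k →
  q ^ k * ((n + k) choose k) ≤ p ^ k * ((t + k) choose k)
choose-ratio p q t n q≤p qn≤pt zero    = ≤-refl
choose-ratio p q t n q≤p qn≤pt (suc k) = subst₂ (λ x y → q ^ suc k * (x choose suc k) ≤ p ^ suc k * (y choose suc k))
  (sym (+-suc n k)) (sym (+-suc t k)) (*-cancelˡ-≤ (suc k) (begin
    suc k * (q ^ suc k * (suc (n + k) choose suc k))   ≡⟨ lemma₁ (suc k) (q ^ suc k) _ ⟩
    q * q ^ k * (suc k * (suc (n + k) choose suc k))   ≡⟨ cong (q ^ suc k *_) (absorption (n + k) k) ⟩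
    q * q ^ k * (suc (n + k) * ((n + k) choose k))     ≡⟨ [m*n]*[o*p]≡[m*o]*[n*p] q (q ^ k) (suc (n + k)) _ ⟩
    q * suc (n + k) * (q ^ k * ((n + k) choose k))     ≤⟨ *-mono-≤ step (choose-ratio p q t n q≤p qn≤pt k) ⟩
    p * suc (t + k) * (p ^ k * ((t + k) choose k))     ≡⟨ [m*n]*[o*p]≡[m*o]*[n*p] p (p ^ k) (suc (t + k)) _ ⟨
    p * p ^ k * (suc (t + k) * ((t + k) choose k))     ≡⟨ cong (p ^ suc k *_) (absorption (t + k) k) ⟨
    p * p ^ k * (suc k * (suc (t + k) choose suc k))   ≡⟨ lemma₁ (suc k) (p ^ suc k) _ ⟨
    suc k * (p ^ suc k * (suc (t + k) choose suc k))   ∎))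
  where
  open ≤-Reasoning
  lemma₁ : ∀ a b c → a * (b * c) ≡ b * (a * c)
  lemma₁ = solve-∀
  step : q * suc (n + k) ≤ p * suc (t + k)
  step = begin
    q * suc (n + k)     ≡⟨ cong (q *_) (+-suc n k) ⟨
    q * (n + suc k)     ≡⟨ *-distribˡ-+ q n (suc k) ⟩
    q * n + q * suc k   ≤⟨ +-mono-≤ qn≤pt (*-monoˡ-≤ (suc k) q≤p) ⟩
    p * t + p * suc k   ≡⟨ *-distribˡ-+ p t (suc k) ⟨
    p * (t + suc k)     ≡⟨ cong (p *_) (+-suc t k) ⟩
    p * suc (t + k)     ∎

-- Padding clauses with fresh variables

open DecMembership _≟L_ using (_∈?_)

-- This is the complete formula on the variables from `v` to `v + d - 1`, with `C` joined to each of
-- its clauses.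
expand : ℕ → Var → Clause → CNF
expand zero    v C = C ∷ []
expand (suc d) v C = expand d (suc v) (pos v ∷ C) ++ expand d (suc v) (neg v ∷ C)

length-expand : ∀ d v C → length (expand d v C) ≡ 2 ^ d
length-expand zero    v C = refl
length-expand (suc d) v C = trans (length-++ (expand d (suc v) (pos v ∷ C)))
  (cong₂ _+_ (length-expand d _ _) (trans (length-expand d _ _) (sym (+-identityʳ (2 ^ d)))))

expand-lengths : ∀ d v C → All (λ D → length D ≡ d + length C) (expand d v C)
expand-lengths zero    v C = refl ∷ []
expand-lengths (suc d) v C = AllP.++⁺ (step _) (step _)
  where
  step : ∀ u → All (λ D → length D ≡ suc d + length C) (expand d (suc v) (u ∷ C))
  step u = All.map (λ e → trans e (+-suc d (length C))) (expand-lengths d (suc v) (u ∷ C))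

expand-⊇ : ∀ d v C {u} → u ∈ C → All (u ∈_) (expand d v C)
expand-⊇ zero    v C u∈ = u∈ ∷ []
expand-⊇ (suc d) v C u∈ = AllP.++⁺ (expand-⊇ d _ _ (there u∈)) (expand-⊇ d _ _ (there u∈))

FromExpand : ℕ → Var → Clause → Literal → Set
FromExpand d v C u = u ∈ C ⊎ (v ≤ var u × var u < v + d)

expand-⊆ : ∀ d v C → All (All (FromExpand d v C)) (expand d v C)
expand-⊆ zero    v C = All.tabulate inj₁ ∷ []
expand-⊆ (suc d) v C = AllP.++⁺ (step true) (step false)
  where
  widen : ∀ b {u} → FromExpand d (suc v) ((v , b) ∷ C) u → FromExpand (suc d) v C u
  widen b (inj₁ (here refl))  = inj₂ (≤-refl , m<m+n v (s≤s z≤n))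
  widen b (inj₁ (there u∈))   = inj₁ u∈
  widen b (inj₂ (lo , hi))    = inj₂ (<⇒≤ lo , <-≤-trans hi (≤-reflexive (sym (+-suc v d))))

  step : ∀ b → All (All (FromExpand (suc d) v C)) (expand d (suc v) ((v , b) ∷ C))
  step b = All.map (All.map (widen b)) (expand-⊆ d (suc v) ((v , b) ∷ C))

below-∷ : ∀ {v b C} → All (λ u → var u < v) C → All (λ u → var u < suc v) ((v , b) ∷ C)
below-∷ lt = ≤-refl ∷ All.map m≤n⇒m≤1+n lt

wf-∷ : ∀ {v b C} → All (λ u → var u < v) C → WellFormedClause C → WellFormedClause ((v , b) ∷ C)
wf-∷ lt wf = All.map (λ u<v v≡u → <⇒≢ u<v (sym v≡u)) lt ∷ wf

expand-wf : ∀ d v C → All (λ u → var u < v) C → WellFormedClause C → All WellFormedClause (expand d v C)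
expand-wf zero    v C lt wf = wf ∷ []
expand-wf (suc d) v C lt wf = AllP.++⁺ (expand-wf d _ _ (below-∷ lt) (wf-∷ lt wf)) (expand-wf d _ _ (below-∷ lt) (wf-∷ lt wf))

wf-no-clash : ∀ {C v} → WellFormedClause C → pos v ∈ C → neg v ∉ C
wf-no-clash (d ∷ wf) (here refl) (there j)   = All.lookup d j refl
wf-no-clash (d ∷ wf) (there i)   (here refl) = All.lookup d i refl
wf-no-clash (d ∷ wf) (there i)   (there j)   = wf-no-clash wf i j

-- Clauses from the two halves contain `v` with opposite signs, so a permutation between them would
-- put both signs into one well-formed clause.
expand-distinct : ∀ d v C → All (λ u → var u < v) C → WellFormedClause C →
  AllPairs (λ D E → ¬ (D ↭ E)) (expand d v C)
expand-distinct zero    v C lt wf = [] ∷ []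
expand-distinct (suc d) v C lt wf = AllPairsP.++⁺
  (expand-distinct d _ _ (below-∷ lt) (wf-∷ lt wf))
  (expand-distinct d _ _ (below-∷ lt) (wf-∷ lt wf))
  (All.zipWith (λ (pos∈D , wfD) → All.map (λ neg∈E D↭E → wf-no-clash wfD pos∈D (∈-resp-↭ (↭-sym D↭E) neg∈E))
                  (expand-⊇ d (suc v) (neg v ∷ C) (here refl)))
    (expand-⊇ d (suc v) (pos v ∷ C) (here refl) , expand-wf d (suc v) (pos v ∷ C) (below-∷ lt) (wf-∷ lt wf)))

-- The first variable of its block marks a padded clause; `pad-distinct` uses this mark to separate
-- the expansions of different base clauses.
expand-fresh : ∀ d v C → All (λ D → Σ Literal λ u → u ∈ D × var u ≡ v) (expand (suc d) v C)
expand-fresh d v C = AllP.++⁺ (step true) (step false)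
  where
  step : ∀ b → All (λ D → Σ Literal λ u → u ∈ D × var u ≡ v) (expand d (suc v) ((v , b) ∷ C))
  step b = All.map (λ u∈ → _ , u∈ , refl) (expand-⊇ d (suc v) ((v , b) ∷ C) (here refl))

-- `α` falsifies one of `pos v` and `neg v`, and in the half that received this literal only `C` is
-- left to be satisfied.
expand-sat : ∀ α d v C → Satisfies α (expand d v C) → SatClause α C
expand-sat α zero    v C (sat ∷ []) = sat
expand-sat α (suc d) v C sats
  with expand-sat α d (suc v) (pos v ∷ C) (AllP.++⁻ˡ (expand d (suc v) (pos v ∷ C)) sats)
     | expand-sat α d (suc v) (neg v ∷ C) (AllP.++⁻ʳ (expand d (suc v) (pos v ∷ C)) sats)
... | there sat | _         = sat
... | here _    | there sat = sat
... | here e    | here e′   = contradiction (trans (sym e) e′) λ ()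

occ-++ : ∀ F G u → occ (F ++ G) u ≡ occ F u + occ G u
occ-++ F G u = trans (cong length (filter-++ (u ∈?_) F G)) (length-++ (filter (u ∈?_) F))

occ-none : ∀ {F u} → All (u ∉_) F → occ F u ≡ 0
occ-none {u = u} h = cong length (filter-none (u ∈?_) h)

occ≤length : ∀ F u → occ F u ≤ length F
occ≤length F u = length-filter (u ∈?_) F

module Padding (n k : ℕ) where

  -- The strict bound in `short` forces a fresh variable into every padded clause. Paddings of two
  -- list entries therefore differ even if the entries coincide as sets.
  record Base (C : Clause) : Set where
    constructor base
    field
      wellFormed : WellFormedClause C
      below      : All (λ u → var u < n) C
      short      : length C < k

  open Base

  gap : Clause → ℕ
  gap C = k ∸ length C

  -- Advancing `v` by `gap C` reserves a separate block of fresh variables for each base clause.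
  pad : Var → CNF → CNF
  pad v []      = []
  pad v (C ∷ G) = expand (gap C) v C ++ pad (v + gap C) G

  below-mono : ∀ {v C} → n ≤ v → Base C → All (λ u → var u < v) C
  below-mono n≤v b = All.map (λ lt → <-≤-trans lt n≤v) (below b)

  n≤v+ : ∀ {v} d → n ≤ v → n ≤ v + d
  n≤v+ d n≤v = ≤-trans n≤v (m≤m+n _ d)

  pad-lengths : ∀ v {G} → All Base G → All (λ D → length D ≡ k) (pad v G)
  pad-lengths v []                 = []
  pad-lengths v {C ∷ G} (b ∷ bs) = AllP.++⁺
    (All.map (λ e → trans e (m∸n+n≡m (<⇒≤ (short b)))) (expand-lengths (gap C) v C))
    (pad-lengths (v + gap C) bs)

  pad-wf : ∀ {v G} → n ≤ v → All Base G → All WellFormedClause (pad v G)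
  pad-wf n≤v []                       = []
  pad-wf {v} {C ∷ G} n≤v (b ∷ bs) = AllP.++⁺
    (expand-wf (gap C) v C (below-mono n≤v b) (wellFormed b))
    (pad-wf (n≤v+ (gap C) n≤v) bs)

  pad-vars : ∀ v {G} → All Base G → All (All (λ u → var u < n ⊎ v ≤ var u)) (pad v G)
  pad-vars v []                 = []
  pad-vars v {C ∷ G} (b ∷ bs) = AllP.++⁺
    (All.map (All.map (λ { (inj₁ u∈C) → inj₁ (All.lookup (below b) u∈C) ; (inj₂ (lo , _)) → inj₂ lo }))
      (expand-⊆ (gap C) v C))
    (All.map (All.map (λ { (inj₁ lt) → inj₁ lt ; (inj₂ ge) → inj₂ (≤-trans (m≤m+n v (gap C)) ge) }))
      (pad-vars (v + gap C) bs))

  pad-distinct : ∀ {v G} → n ≤ v → All Base G → AllPairs (λ D E → ¬ (D ↭ E)) (pad v G)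
  pad-distinct n≤v []                   = []
  pad-distinct {v} {C ∷ G} n≤v (b ∷ bs) = AllPairsP.++⁺
    (expand-distinct (gap C) v C (below-mono n≤v b) (wellFormed b))
    (pad-distinct (n≤v+ (gap C) n≤v) bs)
    (cross (gap C) (m<n⇒0<n∸m (short b)))
    where
    -- Every clause grown from `C` contains the variable `v`, whereas later ones use only variables
    -- below `n` or beyond the block. The gap is generalised to `d` so that its positivity can be
    -- matched as a successor.
    cross : ∀ d → 0 < d → All (λ D → All (λ E → ¬ (D ↭ E)) (pad (v + d) G)) (expand d v C)
    cross (suc d) _ = All.map
      (λ { (u , u∈D , refl) → All.map (λ vars D↭E → absurd (All.lookup vars (∈-resp-↭ D↭E u∈D))) (pad-vars (v + suc d) bs) })
      (expand-fresh d v C)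
      where
      absurd : ¬ (v < n ⊎ v + suc d ≤ v)
      absurd (inj₁ v<n) = <⇒≱ v<n n≤v
      absurd (inj₂ le)  = <⇒≱ (m<m+n v (s≤s z≤n)) le

  pad-isKCNF : ∀ {G} → All Base G → IsKCNF k (pad n G)
  pad-isKCNF bs = (pad-wf ≤-refl bs , pad-distinct ≤-refl bs) , pad-lengths n bs

  pad-sat : ∀ α v G → Satisfies α (pad v G) → Satisfies α G
  pad-sat α v []      sats = []
  pad-sat α v (C ∷ G) sats =
    expand-sat α (gap C) v C (AllP.++⁻ˡ (expand (gap C) v C) sats) ∷
    pad-sat α (v + gap C) G (AllP.++⁻ʳ (expand (gap C) v C) sats)

  occ-expand : ∀ {e} v C u → gap C ≤ e → occ (expand (gap C) v C) u ≤ 2 ^ e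
  occ-expand v C u le = ≤-trans (occ≤length (expand (gap C) v C) u)
    (≤-trans (≤-reflexive (length-expand (gap C) v C)) (^-monoʳ-≤ 2 le))

  occ-expand-none : ∀ d v C {u} → u ∉ C → var u < v ⊎ v + d ≤ var u → occ (expand d v C) u ≡ 0
  occ-expand-none d v C {u} u∉C out = occ-none (All.map (λ vars u∈D → absurd (All.lookup vars u∈D) out) (expand-⊆ d v C))
    where
    absurd : FromExpand d v C u → ¬ (var u < v ⊎ v + d ≤ var u)
    absurd (inj₁ u∈C)      _          = u∉C u∈C
    absurd (inj₂ (lo , _)) (inj₁ lt)  = <⇒≱ lt lo
    absurd (inj₂ (_ , hi)) (inj₂ ge)  = <⇒≱ hi ge

  -- Blocks start at `n` or above, so an original variable enters only through base clauses
  -- containing it. The gap bound concerns just the clauses containing the literal `u`, which allows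
  -- a different `e` for each sign.
  pad-occ-old : ∀ {e v u G} → n ≤ v → var u < n → All (λ C → u ∈ C → gap C ≤ e) G →
    occ (pad v G) u ≤ occ G u * 2 ^ e
  pad-occ-old {G = []} n≤v u<n [] = z≤n
  pad-occ-old {e} {v} {u} {C ∷ G} n≤v u<n (g ∷ gs) with u ∈? C
  ... | yes u∈C = begin
    occ (expand (gap C) v C ++ pad (v + gap C) G) u              ≡⟨ occ-++ (expand (gap C) v C) _ u ⟩
    occ (expand (gap C) v C) u + occ (pad (v + gap C) G) u
      ≤⟨ +-mono-≤ (occ-expand v C u (g u∈C)) (pad-occ-old (n≤v+ (gap C) n≤v) u<n gs) ⟩
    2 ^ e + occ G u * 2 ^ e                                      ∎
    where open ≤-Reasoning
  ... | no u∉C = begin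
    occ (expand (gap C) v C ++ pad (v + gap C) G) u              ≡⟨ occ-++ (expand (gap C) v C) _ u ⟩
    occ (expand (gap C) v C) u + occ (pad (v + gap C) G) u
      ≡⟨ cong (_+ occ (pad (v + gap C) G) u) (occ-expand-none (gap C) v C u∉C (inj₁ (<-≤-trans u<n n≤v))) ⟩
    occ (pad (v + gap C) G) u                                    ≤⟨ pad-occ-old (n≤v+ (gap C) n≤v) u<n gs ⟩
    occ G u * 2 ^ e                                              ∎
    where open ≤-Reasoning

  -- Blocks are disjoint, so a fresh variable meets the expansion of at most one base clause; the
  -- size of that expansion bounds its occurrences.
  pad-occ-fresh : ∀ {e v u G} → n ≤ var u → All Base G → All (λ C → gap C ≤ e) G →
    occ (pad v G) u ≤ 2 ^ e
  pad-occ-fresh n≤u [] [] = z≤n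
  pad-occ-fresh {e} {v} {u} {C ∷ G} n≤u (b ∷ bs) (g ∷ gs) with var u <? v + gap C
  ... | yes lt = begin
    occ (expand (gap C) v C ++ pad (v + gap C) G) u              ≡⟨ occ-++ (expand (gap C) v C) _ u ⟩
    occ (expand (gap C) v C) u + occ (pad (v + gap C) G) u
      ≡⟨ cong (occ (expand (gap C) v C) u +_) (occ-none (All.map (λ vars u∈D → absurd (All.lookup vars u∈D)) (pad-vars (v + gap C) bs))) ⟩
    occ (expand (gap C) v C) u + 0                               ≡⟨ +-identityʳ _ ⟩
    occ (expand (gap C) v C) u                                   ≤⟨ occ-expand v C u g ⟩
    2 ^ e                                                        ∎
    where
    open ≤-Reasoning
    absurd : ¬ (var u < n ⊎ v + gap C ≤ var u)
    absurd (inj₁ u<n) = <⇒≱ u<n n≤u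
    absurd (inj₂ ge)  = <⇒≱ lt ge
  ... | no ≮ = begin
    occ (expand (gap C) v C ++ pad (v + gap C) G) u              ≡⟨ occ-++ (expand (gap C) v C) _ u ⟩
    occ (expand (gap C) v C) u + occ (pad (v + gap C) G) u
      ≡⟨ cong (_+ occ (pad (v + gap C) G) u) (occ-expand-none (gap C) v C (λ u∈C → <⇒≱ (All.lookup (below b) u∈C) n≤u) (inj₂ (≮⇒≥ ≮))) ⟩
    occ (pad (v + gap C) G) u                                    ≤⟨ pad-occ-fresh n≤u bs gs ⟩
    2 ^ e                                                        ∎
    where open ≤-Reasoning

-- Covering all assignments by positive and negative clauses

allVecs : ∀ n → List (Vec Bool n)
allVecs zero    = [] ∷ []
allVecs (suc n) = map (true ∷_) (allVecs n) ++ map (false ∷_) (allVecs n)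

length-allVecs : ∀ n → length (allVecs n) ≡ 2 ^ n
length-allVecs zero    = refl
length-allVecs (suc n) = trans (length-++ (map (true ∷_) (allVecs n)))
  (cong₂ _+_ (trans (length-map _ (allVecs n)) (length-allVecs n))
    (trans (length-map _ (allVecs n)) (trans (length-allVecs n) (sym (+-identityʳ (2 ^ n))))))

∈-allVecs : ∀ {n} (v : Vec Bool n) → v ∈ allVecs n
∈-allVecs []          = here refl
∈-allVecs (true ∷ v)  = ∈-++⁺ˡ (∈-map⁺ (true ∷_) (∈-allVecs v))
∈-allVecs (false ∷ v) = ∈-++⁺ʳ (map (true ∷_) (allVecs _)) (∈-map⁺ (false ∷_) (∈-allVecs v))

-- One more than the floor of `P / Q` is large enough for `halving`, and since `Q ≤ P` it costs at
-- most a factor 2.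
round-up : ∀ P Q .{{_ : NonZero Q}} → Q ≤ P → Σ ℕ λ r → NonZero r × P ≤ r * Q × r * Q ≤ 2 * P
round-up P Q Q≤P = suc (P / Q) , _ ,
  ≤-trans (≤-reflexive (m≡m%n+[m/n]*n P Q)) (+-monoˡ-≤ (P / Q * Q) (<⇒≤ (m%n<n P Q))) ,
  +-mono-≤ Q≤P (≤-trans (m/n*n≤m P Q) (≤-reflexive (sym (+-identityʳ P))))

-- The quotient of `t choose a` by `n choose a` has the factors `(t - i) / (n - i)` for `i < a`;
-- this condition makes all of them at least `q / p`.
Dense : (p q a n t : ℕ) → Set
Dense p q a n t = a ≤ t × q * (n ∸ a) ≤ p * (t ∸ a)

-- For each `v` in `vs`, at least a fraction `(q / p) ^ a` of all `a`-sets of indices satisfies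
-- `g v` throughout. Hence about `(p / q) ^ a` greedy rounds halve the uncovered vectors, of which
-- there are at most `2 ^ n`.
cover-dense : ∀ p q a n .{{_ : NonZero p}} .{{_ : NonZero q}} → q ≤ p → a ≤ n →
  (g : Vec Bool n → Fin n → Bool) (vs : List (Vec Bool n)) → length vs ≤ 2 ^ n →
  All (λ v → Dense p q a n (count (g v) (allFin n))) vs →
  Σ ℕ λ r → r * q ^ a ≤ 2 * p ^ a × Σ (List (List (Fin n))) λ L → length L ≤ r * suc n ×
    All (_∈ combinations a (allFin n)) L × (∀ {v} → v ∈ vs → Any (λ z → all (g v) z ≡ true) L)
cover-dense p q a n q≤p a≤n g vs few dense
  with round-up (p ^ a) (q ^ a) {{m^n≢0 q a}} (^-monoˡ-≤ a q≤p)
... | r , r≢0 , lo , hi = r , hi ,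
  greedy-cover (λ v → all (g v)) (p ^ a) (q ^ a) {{p^a≢0}} Y
    (combinations-nonempty a (allFin n) (≤-trans a≤n (≤-reflexive (sym len)))) (r * suc n) vs
    (All.map (λ {v} → hits v) dense)
    (≤-<-trans (*-monoˡ-≤ _ few) (enough-rounds (p ^ a) (q ^ a) r n {{r≢0}} {{p^a≢0}} (^-monoˡ-≤ a q≤p) lo))
  where
  p^a≢0 = m^n≢0 p a
  Y = combinations a (allFin n)
  len : length (allFin n) ≡ n
  len = length-tabulate {n = n} (λ i → i)

  hits : ∀ v → Dense p q a n (count (g v) (allFin n)) → q ^ a * length Y ≤ p ^ a * count (all (g v)) Y
  hits v (a≤t , d) = begin
    q ^ a * length Y                      ≡⟨ cong (q ^ a *_) (length-combinations a (allFin n)) ⟩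
    q ^ a * (length (allFin n) choose a)       ≡⟨ cong (λ m → q ^ a * (m choose a)) (trans len (sym (m∸n+n≡m a≤n))) ⟩
    q ^ a * ((n ∸ a + a) choose a)             ≤⟨ choose-ratio p q (t ∸ a) (n ∸ a) q≤p d a ⟩
    p ^ a * ((t ∸ a + a) choose a)             ≡⟨ cong (λ m → p ^ a * (m choose a)) (m∸n+n≡m a≤t) ⟩
    p ^ a * (t choose a)                       ≡⟨ cong (p ^ a *_) (count-all-combinations (g v) a (allFin n)) ⟨
    p ^ a * count (all (g v)) Y           ∎
    where
    open ≤-Reasoning
    t = count (g v) (allFin n)

literals : ∀ {n} → Bool → List (Fin n) → Clause
literals b = map (λ i → toℕ i , b)

literals-wf : ∀ {n} a b {z : List (Fin n)} → z ∈ combinations a (allFin n) → WellFormedClause (literals b z)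
literals-wf {n} a b z∈ = AllPairsP.map⁺
  (AllPairs.map (λ i≢j e → i≢j (toℕ-injective e)) (All.lookup (AllPairs-combinations a (allFin⁺ n)) z∈))

literals-below : ∀ {n} b (z : List (Fin n)) → All (λ u → var u < n) (literals b z)
literals-below b z = AllP.map⁺ (All.universal toℕ<n z)

literals-length : ∀ {n} a b {z : List (Fin n)} → z ∈ combinations a (allFin n) → length (literals b z) ≡ a
literals-length {n} a b {z} z∈ = trans (length-map _ z) (All.lookup (length-∈-combinations a (allFin n)) z∈)

literals-sign : ∀ {n} b b′ (z : List (Fin n)) {x} → (x , b′) ∈ literals b z → b′ ≡ b
literals-sign b b′ (i ∷ z) (here refl) = refl
literals-sign b b′ (i ∷ z) (there u∈)  = literals-sign b b′ z u∈

literals-falsified : ∀ {n} b (α : Assignment) (g : Fin n → Bool) → (∀ i → g i ≡ true → α (toℕ i) ≢ b) →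
  ∀ z → all g z ≡ true → ¬ SatClause α (literals b z)
literals-falsified b α g bad (i ∷ z) e sat with g i in eq
literals-falsified b α g bad (i ∷ z) e (here s)    | true = bad i eq s
literals-falsified b α g bad (i ∷ z) e (there sat) | true = literals-falsified b α g bad z e sat

dense? : ∀ p q a n t → Dec (Dense p q a n t)
dense? p q a n t = (a ≤? t) ×-dec (q * (n ∸ a) ≤? p * (t ∸ a))

signed : ∀ {n} → List (List (Fin n)) → List (List (Fin n)) → CNF
signed P Q = map (literals true) P ++ map (literals false) Q

record TwoSided (n a b A B : ℕ) : Set where
  field
    P Q   : List (List (Fin n))
    ∣P∣≤A : length P ≤ A
    ∣Q∣≤B : length Q ≤ B
    P⊆    : All (_∈ combinations a (allFin n)) P
    Q⊆    : All (_∈ combinations b (allFin n)) Q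
    unsat : Unsatisfiable (signed P Q)

any-falsified : ∀ {A : Set} {α} (f : A → Clause) {R : A → Set} → (∀ z → R z → ¬ SatClause α (f z)) →
  ∀ {zs} → Any R zs → ¬ Satisfies α (map f zs)
any-falsified f bad (here r)  (s ∷ _)  = bad _ r s
any-falsified f bad (there i) (_ ∷ ss) = any-falsified f bad i ss

restrict : ∀ n → Assignment → Vec Bool n
restrict n α = tabulate (λ i → α (toℕ i))

-- Positive clauses take care of the vectors with many false entries, negative clauses of those with
-- many true entries. By the dichotomy no vector escapes both families; the families may overlap.
two-sided : ∀ p q p′ q′ a b n .{{_ : NonZero p}} .{{_ : NonZero q}} .{{_ : NonZero p′}} .{{_ : NonZero q′}} →
  q ≤ p → q′ ≤ p′ → a ≤ n → b ≤ n →
  (∀ s t → s + t ≡ n → Dense p q a n t ⊎ Dense p′ q′ b n s) →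
  Σ ℕ λ r → Σ ℕ λ r′ → r * q ^ a ≤ 2 * p ^ a × r′ * q′ ^ b ≤ 2 * p′ ^ b ×
    TwoSided n a b (r * suc n) (r′ * suc n)
two-sided p q p′ q′ a b n q≤p q′≤p′ a≤n b≤n dichotomy
  with cover-dense p q a n q≤p a≤n falses (filter false? (allVecs n)) (few false?) (AllP.all-filter false? (allVecs n))
     | cover-dense p′ q′ b n q′≤p′ b≤n lookup (filter true? (allVecs n)) (few true?) (AllP.all-filter true? (allVecs n))
  where
  falses : Vec Bool n → Fin n → Bool
  falses v i = not (lookup v i)
  false? : ∀ v → Dec (Dense p q a n (count (falses v) (allFin n)))
  false? v = dense? p q a n _
  true? : ∀ v → Dec (Dense p′ q′ b n (count (lookup v) (allFin n)))
  true? v = dense? p′ q′ b n _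
  few : ∀ {D : Vec Bool n → Set} (D? : ∀ v → Dec (D v)) → length (filter D? (allVecs n)) ≤ 2 ^ n
  few D? = ≤-trans (length-filter D? (allVecs n)) (≤-reflexive (length-allVecs n))
... | r , r-bound , P , ∣P∣ , P⊆ , P-cover | r′ , r′-bound , Q , ∣Q∣ , Q⊆ , Q-cover =
  r , r′ , r-bound , r′-bound , record
    { P = P ; Q = Q ; ∣P∣≤A = ∣P∣ ; ∣Q∣≤B = ∣Q∣ ; P⊆ = P⊆ ; Q⊆ = Q⊆ ; unsat = unsat }
  where
  unsat : Unsatisfiable (signed P Q)
  unsat α sats with dichotomy (count (lookup (restrict n α)) (allFin n))
                      (count (λ i → not (lookup (restrict n α) i)) (allFin n))
                      (trans (count+count-not (lookup (restrict n α)) (allFin n)) (length-tabulate {n = n} (λ i → i)))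
  ... | inj₁ d = any-falsified (literals true) (literals-falsified true α _ not-true)
        (P-cover {restrict n α} (∈-filter⁺ _ (∈-allVecs _) d)) (AllP.++⁻ˡ (map (literals true) P) sats)
    where
    not-true : ∀ i → not (lookup (restrict n α) i) ≡ true → α (toℕ i) ≢ true
    not-true i e e′ rewrite lookup∘tabulate (λ i → α (toℕ i)) i | e′ = contradiction e λ ()
  ... | inj₂ d = any-falsified (literals false) (literals-falsified false α _ not-false)
        (Q-cover {restrict n α} (∈-filter⁺ _ (∈-allVecs _) d)) (AllP.++⁻ʳ (map (literals true) P) sats)
    where
    not-false : ∀ i → lookup (restrict n α) i ≡ true → α (toℕ i) ≢ false
    not-false i e e′ rewrite lookup∘tabulate (λ i → α (toℕ i)) i | e′ = contradiction e λ ()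

-- The first alternative serves original variables, with a separate gap for each sign. The second
-- serves fresh variables, for which `k ∸ b` is the larger of the two gaps once `b ≤ a`.
OccBound : (A B a b k : ℕ) → CNF → Var → Set
OccBound A B a b k F x =
  (occ F (pos x) ≤ A * 2 ^ (k ∸ a) × occ F (neg x) ≤ B * 2 ^ (k ∸ b)) ⊎
  (occ F (pos x) ≤ 2 ^ (k ∸ b) × occ F (neg x) ≤ 2 ^ (k ∸ b))

-- A positive literal of an original variable occurs only in clauses grown from `P`, a negative one
-- only in clauses grown from `Q`. So each sign pays for its own clause count and its own gap.
padded : ∀ {n a b A B} k → b ≤ a → a < k → TwoSided n a b A B →
  Σ CNF λ F → IsKCNF k F × Unsatisfiable F × (∀ x → OccBound A B a b k F x)
padded {n} {a} {b} {A} {B} k b≤a a<k base-formula =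
  pad n G , pad-isKCNF bases , (λ α sats → unsat α (pad-sat α n G sats)) , bounds
  where
  open Padding n k
  open TwoSided base-formula
  G = signed P Q

  clauses : ∀ {L} s m {R : Clause → Set} → All (_∈ combinations m (allFin n)) L →
    (∀ {z} → z ∈ combinations m (allFin n) → R (literals s z)) → All R (map (literals s) L)
  clauses s m L⊆ f = AllP.map⁺ (All.map f L⊆)

  bases : All Base G
  bases = AllP.++⁺
    (clauses true a P⊆ λ {z} z∈ → base (literals-wf a true z∈) (literals-below true z)
      (≤-<-trans (≤-reflexive (literals-length a true z∈)) a<k))
    (clauses false b Q⊆ λ {z} z∈ → base (literals-wf b false z∈) (literals-below false z)
      (≤-<-trans (≤-reflexive (literals-length b false z∈)) (≤-<-trans b≤a a<k)))

  gap-≡ : ∀ s m {z} → z ∈ combinations m (allFin n) → gap (literals s z) ≡ k ∸ m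
  gap-≡ s m z∈ = cong (k ∸_) (literals-length m s z∈)

  pos∉Q : ∀ x → All (pos x ∉_) (map (literals false) Q)
  pos∉Q x = clauses false b Q⊆ λ {z} _ u∈ → contradiction (literals-sign false true z u∈) λ ()

  neg∉P : ∀ x → All (neg x ∉_) (map (literals true) P)
  neg∉P x = clauses true a P⊆ λ {z} _ u∈ → contradiction (literals-sign true false z u∈) λ ()

  occ-pos : ∀ x → occ G (pos x) ≤ A
  occ-pos x = begin
    occ G (pos x)                          ≡⟨ occ-++ (map (literals true) P) _ (pos x) ⟩
    occ (map (literals true) P) (pos x) + occ (map (literals false) Q) (pos x)
      ≡⟨ cong (occ (map (literals true) P) (pos x) +_) (occ-none (pos∉Q x)) ⟩
    occ (map (literals true) P) (pos x) + 0 ≡⟨ +-identityʳ _ ⟩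
    occ (map (literals true) P) (pos x)    ≤⟨ occ≤length (map (literals true) P) (pos x) ⟩
    length (map (literals true) P)         ≡⟨ length-map (literals true) P ⟩
    length P                               ≤⟨ ∣P∣≤A ⟩
    A                                      ∎
    where open ≤-Reasoning

  occ-neg : ∀ x → occ G (neg x) ≤ B
  occ-neg x = begin
    occ G (neg x)                          ≡⟨ occ-++ (map (literals true) P) _ (neg x) ⟩
    occ (map (literals true) P) (neg x) + occ (map (literals false) Q) (neg x)
      ≡⟨ cong (_+ occ (map (literals false) Q) (neg x)) (occ-none (neg∉P x)) ⟩
    occ (map (literals false) Q) (neg x)   ≤⟨ occ≤length (map (literals false) Q) (neg x) ⟩
    length (map (literals false) Q)        ≡⟨ length-map (literals false) Q ⟩
    length Q                               ≤⟨ ∣Q∣≤B ⟩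
    B                                      ∎
    where open ≤-Reasoning

  bounds : ∀ x → OccBound A B a b k (pad n G) x
  bounds x with x <? n
  ... | yes x<n = inj₁
    ( ≤-trans (pad-occ-old ≤-refl x<n pos-gaps) (*-monoˡ-≤ _ (occ-pos x))
    , ≤-trans (pad-occ-old ≤-refl x<n neg-gaps) (*-monoˡ-≤ _ (occ-neg x)) )
    where
    pos-gaps : All (λ C → pos x ∈ C → gap C ≤ k ∸ a) G
    pos-gaps = AllP.++⁺ (clauses true a P⊆ λ z∈ _ → ≤-reflexive (gap-≡ true a z∈))
      (All.map (λ ∉C ∈C → contradiction ∈C ∉C) (pos∉Q x))
    neg-gaps : All (λ C → neg x ∈ C → gap C ≤ k ∸ b) G
    neg-gaps = AllP.++⁺ (All.map (λ ∉C ∈C → contradiction ∈C ∉C) (neg∉P x))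
      (clauses false b Q⊆ λ z∈ _ → ≤-reflexive (gap-≡ false b z∈))
  ... | no x≮n = inj₂
    ( pad-occ-fresh (≮⇒≥ x≮n) bases gaps , pad-occ-fresh (≮⇒≥ x≮n) bases gaps )
    where
    gaps : All (λ C → gap C ≤ k ∸ b) G
    gaps = AllP.++⁺
      (clauses true a P⊆ λ z∈ → ≤-trans (≤-reflexive (gap-≡ true a z∈)) (∸-monoʳ-≤ k b≤a))
      (clauses false b Q⊆ λ z∈ → ≤-reflexive (gap-≡ false b z∈))

-- Numerical estimates

-- This exposes `j`-th powers, so that a numerical inequality need be checked for `j = 1` only.
pow-swap : ∀ m c j → m ^ (j * c) ≡ (m ^ c) ^ j
pow-swap m c j = trans (cong (m ^_) (*-comm j c)) (sym (^-*-assoc m c j))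

-- With n = 52287 j variables, s true and t false: if 6 t < 5 n + 39 j then s ≥ 8708 j, and the
-- loss from 1/6 to 100/601 absorbs the terms of order a and b.
dichotomy : ∀ j s t → s + t ≡ j * 52287 →
  Dense 6 5 (j * 39) (j * 52287) t ⊎ Dense 601 100 (j * 8) (j * 52287) s
dichotomy j s t s+t≡n with 5 * (j * 52287) + j * 39 ≤? 6 * t
... | yes le = inj₁ (a≤t , dense)
  where
  open ≤-Reasoning
  a = j * 39
  n = j * 52287
  a≤n : a ≤ n
  a≤n = *-monoʳ-≤ j (≤ᵇ⇒≤ 39 52287 tt)
  five : ∀ x → 5 * x + x ≡ 6 * x
  five = solve-∀
  a≤t : a ≤ t
  a≤t = *-cancelˡ-≤ 6 (begin
    6 * a         ≡⟨ five a ⟨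
    5 * a + a     ≤⟨ +-monoˡ-≤ a (*-monoʳ-≤ 5 a≤n) ⟩
    5 * n + a     ≤⟨ le ⟩
    6 * t         ∎)
  dense : 5 * (n ∸ a) ≤ 6 * (t ∸ a)
  dense = +-cancelʳ-≤ (6 * a) _ _ (begin
    5 * (n ∸ a) + 6 * a       ≡⟨ lemma (n ∸ a) a ⟩
    5 * (n ∸ a + a) + a       ≡⟨ cong (λ z → 5 * z + a) (m∸n+n≡m a≤n) ⟩
    5 * n + a                 ≤⟨ le ⟩
    6 * t                     ≡⟨ cong (6 *_) (m∸n+n≡m a≤t) ⟨
    6 * (t ∸ a + a)           ≡⟨ *-distribˡ-+ 6 (t ∸ a) a ⟩
    6 * (t ∸ a) + 6 * a       ∎)
    where
    lemma : ∀ x y → 5 * x + 6 * y ≡ 5 * (x + y) + y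
    lemma = solve-∀
... | no ≰ = inj₂ (≤-trans (m≤n+m (j * 8) (j * 8700)) j8708≤s , dense)
  where
  open ≤-Reasoning
  n = j * 52287
  n<6s+a : n < 6 * s + j * 39
  n<6s+a = +-cancelˡ-< (5 * n) _ _ (begin-strict
    5 * n + n                       ≡⟨ five n ⟩
    6 * n                           ≡⟨ cong (6 *_) s+t≡n ⟨
    6 * (s + t)                     ≡⟨ *-distribˡ-+ 6 s t ⟩
    6 * s + 6 * t                   <⟨ +-monoʳ-< (6 * s) (≰⇒> ≰) ⟩
    6 * s + (5 * n + j * 39)        ≡⟨ lemma (6 * s) (5 * n) (j * 39) ⟩
    5 * n + (6 * s + j * 39)        ∎)
    where
    five : ∀ x → 5 * x + x ≡ 6 * x
    five = solve-∀
    lemma : ∀ x y z → x + (y + z) ≡ y + (x + z)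
    lemma = solve-∀
  -- Since 52287 = 6 * 8708 + 39, the term `j * 39` cancels exactly. Splitting off `j * 8` leaves
  -- `j * 8700` as a lower bound for `s ∸ j * 8`.
  j8708≤s : j * 8700 + j * 8 ≤ s
  j8708≤s = *-cancelˡ-≤ 6 (+-cancelʳ-≤ (j * 39) _ _ (begin
    6 * (j * 8700 + j * 8) + j * 39   ≡⟨ cong (λ z → 6 * z + j * 39) (*-distribˡ-+ j 8700 8) ⟨
    6 * (j * 8708) + j * 39           ≡⟨ cong (_+ j * 39) (trans (*-comm 6 (j * 8708)) (*-assoc j 8708 6)) ⟩
    j * 52248 + j * 39                ≡⟨ *-distribˡ-+ j 52248 39 ⟨
    n                                 ≤⟨ <⇒≤ n<6s+a ⟩
    6 * s + j * 39                    ∎))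
  dense : 100 * (n ∸ j * 8) ≤ 601 * (s ∸ j * 8)
  dense = begin
    100 * (n ∸ j * 8)      ≡⟨ cong (100 *_) (*-distribˡ-∸ j 52287 8) ⟨
    100 * (j * 52279)      ≡⟨ trans (*-comm 100 (j * 52279)) (*-assoc j 52279 100) ⟩
    j * 5227900            ≤⟨ *-monoʳ-≤ j (≤ᵇ⇒≤ 5227900 5228700 tt) ⟩
    j * 5228700            ≡⟨ trans (*-comm 601 (j * 8700)) (*-assoc j 8700 601) ⟨
    601 * (j * 8700)       ≤⟨ *-monoʳ-≤ 601 (m+n≤o⇒m≤o∸n (j * 8700) j8708≤s) ⟩
    601 * (s ∸ j * 8)      ∎

-- By `bernoulli` with `d = 1`, the growth of `(1 + 1 / e) ^ j` absorbs the linear factor up to the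
-- constant `w * e`.
linear≤exponential : ∀ w e e′ j → 1 ≤ w → 1 ≤ e → e + 1 ≡ e′ → suc (j * w) * e ^ j ≤ w * e * e′ ^ j
linear≤exponential w e e′ j 1≤w 1≤e refl = begin
  suc (j * w) * e ^ j            ≤⟨ *-monoˡ-≤ (e ^ j) (+-monoˡ-≤ (j * w) (*-mono-≤ 1≤w 1≤e)) ⟩
  (w * e + j * w) * e ^ j        ≡⟨ lemma w e j (e ^ j) ⟩
  w * (e ^ j * (e + j * 1))      ≤⟨ *-monoʳ-≤ w (bernoulli e 1 j) ⟩
  w * (e * (e + 1) ^ j)          ≡⟨ *-assoc w e _ ⟨
  w * e * (e + 1) ^ j            ∎
  where
  open ≤-Reasoning
  lemma : ∀ w e j x → (w * e + j * w) * x ≡ w * (x * (e + j * 1))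
  lemma = solve-∀

-- The hypotheses amount to `r ≤ 2 A / X`, `r′ ≤ 2 B / Y` and `N ≤ M D / E`. They are multiplied,
-- the last one twice, with denominators cleared; `T / H` will be the power of 3.01 and `S` the
-- extra padding of the negative clauses.
combine-rates : ∀ r r′ N M A B D X Y E S H T .{{_ : NonZero X}} .{{_ : NonZero Y}} .{{_ : NonZero E}} →
  r * X ≤ 2 * A → r′ * Y ≤ 2 * B → N * E ≤ M * D →
  A * B * (D * D) * (S * H) ≤ T * (X * Y * (E * E)) →
  r * N * (r′ * N * S) * H ≤ 4 * (M * M) * T
combine-rates r r′ N M A B D X Y E S H T rX rY NE rate =
  *-cancelʳ-≤ _ _ (X * Y * (E * E)) {{XYEE≢0}} (begin
    r * N * (r′ * N * S) * H * (X * Y * (E * E))          ≡⟨ lemma₁ r N r′ S H X Y E ⟩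
    (r * X) * (r′ * Y) * ((N * E) * (N * E)) * (S * H)    ≤⟨ *-monoˡ-≤ (S * H) (*-mono-≤ (*-mono-≤ rX rY) (*-mono-≤ NE NE)) ⟩
    (2 * A) * (2 * B) * ((M * D) * (M * D)) * (S * H)     ≡⟨ lemma₂ A B M D (S * H) ⟩
    4 * (M * M) * (A * B * (D * D) * (S * H))             ≤⟨ *-monoʳ-≤ (4 * (M * M)) rate ⟩
    4 * (M * M) * (T * (X * Y * (E * E)))                 ≡⟨ *-assoc (4 * (M * M)) T _ ⟨
    4 * (M * M) * T * (X * Y * (E * E))                   ∎)
  where
  open ≤-Reasoning
  XYEE≢0 : NonZero (X * Y * (E * E))
  XYEE≢0 = m*n≢0 (X * Y) (E * E) {{m*n≢0 X Y}} {{m*n≢0 E E}}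
  lemma₁ : ∀ r N r′ S H X Y E → r * N * (r′ * N * S) * H * (X * Y * (E * E)) ≡
    (r * X) * (r′ * Y) * ((N * E) * (N * E)) * (S * H)
  lemma₁ = solve-∀
  lemma₂ : ∀ A B M D Z → (2 * A) * (2 * B) * ((M * D) * (M * D)) * Z ≡ 4 * (M * M) * (A * B * (D * D) * Z)
  lemma₂ = solve-∀

rate-power : ∀ a b d s h t x y e j → a * b * (d * d) * (s * h) ≤ t * (x * y * (e * e)) →
  a ^ j * b ^ j * (d ^ j * d ^ j) * (s ^ j * h ^ j) ≤ t ^ j * (x ^ j * y ^ j * (e ^ j * e ^ j))
rate-power a b d s h t x y e j le = begin
  a ^ j * b ^ j * (d ^ j * d ^ j) * (s ^ j * h ^ j)
    ≡⟨ cong₂ _*_ (quad a b d d) (^-distribʳ-* s h j) ⟨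
  (a * b * (d * d)) ^ j * (s * h) ^ j         ≡⟨ ^-distribʳ-* (a * b * (d * d)) (s * h) j ⟨
  (a * b * (d * d) * (s * h)) ^ j             ≤⟨ ^-monoˡ-≤ j le ⟩
  (t * (x * y * (e * e))) ^ j                 ≡⟨ ^-distribʳ-* t (x * y * (e * e)) j ⟩
  t ^ j * (x * y * (e * e)) ^ j               ≡⟨ cong (t ^ j *_) (quad x y e e) ⟩
  t ^ j * (x ^ j * y ^ j * (e ^ j * e ^ j))   ∎
  where
  open ≤-Reasoning
  quad : ∀ a b c d → (a * b * (c * d)) ^ j ≡ a ^ j * b ^ j * (c ^ j * d ^ j)
  quad a b c d = trans (^-distribʳ-* (a * b) (c * d) j) (cong₂ _*_ (^-distribʳ-* a b j) (^-distribʳ-* c d j))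

-- Opaque because conversion checking would unfold multiplication by such a literal.
opaque
  factor : ℕ
  factor = 4 * ((52287 * 80) * (52287 * 80))

  -- In `factor`, the 4 comes from the two uses of `round-up`, and `52287 * 80` is the constant of
  -- `linear≤exponential`, squared because `suc (j * 52287)` occurs once for each sign.
  old-estimate : ∀ j r r′ → r * 5 ^ (j * 39) ≤ 2 * 6 ^ (j * 39) → r′ * 100 ^ (j * 8) ≤ 2 * 601 ^ (j * 8) →
    r * suc (j * 52287) * (r′ * suc (j * 52287) * 2 ^ (j * 31)) * 100 ^ (j * 39) ≤
    factor * 301 ^ (j * 39)
  old-estimate j r r′ r-bound r′-bound = combine-rates r r′ (suc (j * 52287)) (52287 * 80)
    (6 ^ (j * 39)) (601 ^ (j * 8)) (81 ^ j) (5 ^ (j * 39)) (100 ^ (j * 8)) (80 ^ j) (2 ^ (j * 31)) (100 ^ (j * 39)) (301 ^ (j * 39))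
    {{m^n≢0 5 (j * 39)}} {{m^n≢0 100 (j * 8)}} {{m^n≢0 80 j}}
    r-bound r′-bound (linear≤exponential 52287 80 81 j (s≤s z≤n) (s≤s z≤n) refl) rate
    where
    rate : 6 ^ (j * 39) * 601 ^ (j * 8) * (81 ^ j * 81 ^ j) * (2 ^ (j * 31) * 100 ^ (j * 39)) ≤
      301 ^ (j * 39) * (5 ^ (j * 39) * 100 ^ (j * 8) * (80 ^ j * 80 ^ j))
    rate rewrite pow-swap 6 39 j | pow-swap 601 8 j | pow-swap 2 31 j | pow-swap 100 39 j
               | pow-swap 301 39 j | pow-swap 5 39 j | pow-swap 100 8 j
      -- Evaluation decides the case `j = 1`, which is `(6/5)^39 * 6.01^8 * (81/80)^2 * 2^31 ≤
      -- 3.01^39` with denominators cleared.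
      = rate-power (6 ^ 39) (601 ^ 8) 81 (2 ^ 31) (100 ^ 39) (301 ^ 39) (5 ^ 39) (100 ^ 8) 80 j (≤ᵇ⇒≤ _ _ tt)

  factor≢0 : NonZero factor
  factor≢0 = _

2^-square-mono-≤ : ∀ {m n} → m ≤ n → 2 ^ m * 2 ^ m ≤ 2 ^ n * 2 ^ n
2^-square-mono-≤ m≤n = *-mono-≤ (^-monoʳ-≤ 2 m≤n) (^-monoʳ-≤ 2 m≤n)

-- The remainder `R` costs up to `2 ^ R` for each sign, hence at most `4 ^ 39` in the product,
-- uniformly in `k`.
opaque
  residue : ℕ
  residue = 2 ^ 39 * 2 ^ 39

  residue-bound : ∀ {R} → R ≤ 39 → 2 ^ R * 2 ^ R ≤ residue
  residue-bound = 2^-square-mono-≤ {n = 39}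

-- The case `j = 1` is `4^31 ≤ 3.01^39`, which holds by less than one part in a thousand; the ratio
-- 8 / 39 leaves almost no room here.
fresh-estimate : ∀ j → 2 ^ (j * 31) * 2 ^ (j * 31) * 100 ^ (j * 39) ≤ 301 ^ (j * 39)
fresh-estimate j rewrite pow-swap 2 31 j | pow-swap 100 39 j | pow-swap 301 39 j
  | sym (^-distribʳ-* (2 ^ 31) (2 ^ 31) j) | sym (^-distribʳ-* (2 ^ 31 * 2 ^ 31) (100 ^ 39) j)
  = ^-monoˡ-≤ j (≤ᵇ⇒≤ _ _ tt)

-- `4 ^ R` exceeds `3.01 ^ R` for positive `R`, so the last `R` positions are paid for by the
-- constant `K`; from the rates only `100 ^ R ≤ 301 ^ R` is taken.
scale : ∀ R K H T U W → 2 ^ R * 2 ^ R ≤ K → U * H ≤ W * T →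
  U * (2 ^ R * 2 ^ R) * (100 ^ R * H) ≤ W * K * (301 ^ R * T)
scale R K H T U W 4^R≤K UH≤WT = begin
  U * (2 ^ R * 2 ^ R) * (100 ^ R * H)      ≡⟨ lemma₁ U (2 ^ R * 2 ^ R) (100 ^ R) H ⟩
  U * H * ((2 ^ R * 2 ^ R) * 100 ^ R)      ≤⟨ *-mono-≤ UH≤WT (*-mono-≤ 4^R≤K (^-monoˡ-≤ R (≤ᵇ⇒≤ 100 301 tt))) ⟩
  W * T * (K * 301 ^ R)                    ≡⟨ lemma₂ W T K (301 ^ R) ⟩
  W * K * (301 ^ R * T)                    ∎
  where
  open ≤-Reasoning
  lemma₁ : ∀ U S X H → U * S * (X * H) ≡ U * H * (S * X)
  lemma₁ = solve-∀
  lemma₂ : ∀ W T K X → W * T * (K * X) ≡ W * K * (X * T)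
  lemma₂ = solve-∀

scaled-product : ∀ {R j o o′} K W U U′ → 2 ^ R * 2 ^ R ≤ K →
  o ≤ U * 2 ^ R → o′ ≤ U′ * 2 ^ R → U * U′ * 100 ^ (j * 39) ≤ W * 301 ^ (j * 39) →
  o * o′ * 100 ^ (R + j * 39) ≤ W * K * 301 ^ (R + j * 39)
scaled-product {R} {j} {o} {o′} K W U U′ 4^R≤K o≤ o′≤ le = begin
  o * o′ * 100 ^ (R + j * 39)                                 ≤⟨ *-monoˡ-≤ _ (*-mono-≤ o≤ o′≤) ⟩
  U * 2 ^ R * (U′ * 2 ^ R) * 100 ^ (R + j * 39)
    ≡⟨ cong₂ _*_ ([m*n]*[o*p]≡[m*o]*[n*p] U (2 ^ R) U′ (2 ^ R)) (^-distribˡ-+-* 100 R (j * 39)) ⟩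
  U * U′ * (2 ^ R * 2 ^ R) * (100 ^ R * 100 ^ (j * 39))       ≤⟨ scale R K _ _ (U * U′) W 4^R≤K le ⟩
  W * K * (301 ^ R * 301 ^ (j * 39))                          ≡⟨ cong (W * K *_) (^-distribˡ-+-* 301 R (j * 39)) ⟨
  W * K * 301 ^ (R + j * 39)                                  ∎
  where open ≤-Reasoning

-- Assembling the formula for each clause size

FormulaWithBound : (W K k : ℕ) → Set
FormulaWithBound W K k = Σ CNF λ F → IsKCNF k F × Unsatisfiable F ×
  ((x : Var) → occ F (pos x) * occ F (neg x) * 100 ^ k ≤ W * K * 301 ^ k)

construct : ∀ j R K → 0 < R → 2 ^ R * 2 ^ R ≤ K → FormulaWithBound factor K (R + j * 39)
construct j R K 0<R 4^R≤K =
  let p , q , p-bound , q-bound , base-formula =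
        two-sided 6 5 601 100 (j * 39) (j * 8) (j * 52287) (≤ᵇ⇒≤ 5 6 tt) (≤ᵇ⇒≤ 100 601 tt)
          (*-monoʳ-≤ j (≤ᵇ⇒≤ 39 52287 tt)) (*-monoʳ-≤ j (≤ᵇ⇒≤ 8 52287 tt)) (dichotomy j)
      F , isK , unsat , bounds =
        padded (R + j * 39) (*-monoʳ-≤ j (≤ᵇ⇒≤ 8 39 tt)) (m<n+m (j * 39) 0<R) base-formula
  in F , isK , unsat , λ x → product p q F x p-bound q-bound (bounds x)
  where
  k = R + j * 39
  N = suc (j * 52287)

  pos-gap : k ∸ j * 39 ≡ R
  pos-gap = m+n∸n≡m R (j * 39)

  -- The exponent 31 is 39 - 8, the additional padding per unit of `j` that negative clauses
  -- receive.
  neg-gap : 2 ^ (k ∸ j * 8) ≡ 2 ^ (j * 31) * 2 ^ R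
  neg-gap = begin
    2 ^ (R + j * 39 ∸ j * 8)           ≡⟨ cong (λ z → 2 ^ (R + z ∸ j * 8)) (*-distribˡ-+ j 31 8) ⟩
    2 ^ (R + (j * 31 + j * 8) ∸ j * 8) ≡⟨ cong (λ z → 2 ^ (z ∸ j * 8)) (+-assoc R (j * 31) (j * 8)) ⟨
    2 ^ (R + j * 31 + j * 8 ∸ j * 8)   ≡⟨ cong (2 ^_) (trans (m+n∸n≡m (R + j * 31) (j * 8)) (+-comm R (j * 31))) ⟩
    2 ^ (j * 31 + R)                   ≡⟨ ^-distribˡ-+-* 2 (j * 31) R ⟩
    2 ^ (j * 31) * 2 ^ R               ∎
    where open ≡-Reasoning

  product : ∀ p q F x → p * 5 ^ (j * 39) ≤ 2 * 6 ^ (j * 39) → q * 100 ^ (j * 8) ≤ 2 * 601 ^ (j * 8) →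
    OccBound (p * N) (q * N) (j * 39) (j * 8) k F x →
    occ F (pos x) * occ F (neg x) * 100 ^ k ≤ factor * K * 301 ^ k
  product p q F x p-bound q-bound (inj₁ (o≤ , o′≤)) = scaled-product {R} {j} K factor (p * N) (q * N * 2 ^ (j * 31)) 4^R≤K
    (≤-trans o≤ (≤-reflexive (cong (λ z → p * N * 2 ^ z) pos-gap)))
    (≤-trans o′≤ (≤-reflexive (trans (cong (q * N *_) neg-gap) (sym (*-assoc (q * N) _ _)))))
    (old-estimate j p q p-bound q-bound)
  product p q F x p-bound q-bound (inj₂ (o≤ , o′≤)) = scaled-product {R} {j} K factor (2 ^ (j * 31)) (2 ^ (j * 31)) 4^R≤K
    (≤-trans o≤ (≤-reflexive neg-gap)) (≤-trans o′≤ (≤-reflexive neg-gap))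
    -- Fresh variables meet the bound with constant 1, which is weakened to the common `factor`.
    (≤-trans (fresh-estimate j) (m≤n*m (301 ^ (j * 39)) factor {{factor≢0}}))

-- Dividing `k - 1` instead of `k` by 39 moves the remainder into the range from 1 to 39, so the
-- positive clauses, of size `j * 39`, are strictly shorter than `k`.
positive-remainder : ∀ k → 1 ≤ k → Σ ℕ λ j → Σ ℕ λ R → 0 < R × R ≤ 39 × R + j * 39 ≡ k
positive-remainder (suc k) _ =
  k / 39 , suc (k % 39) , s≤s z≤n , m%n<n k 39 , cong suc (sym (m≡m%n+[m/n]*n k 39))

theorem3 : Σ ℕ λ c → Σ ℕ λ k₀ → (k : ℕ) → k₀ ≤ k →
    Σ CNF λ F → IsKCNF k F × Unsatisfiable F ×
    ((x : Var) → occ F (pos x) * occ F (neg x) * 100 ^ k ≤ c * 301 ^ k)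
-- The threshold is 1 because 0 has no decomposition with a positive remainder.
theorem3 = factor * residue , 1 , λ k 1≤k →
  let j , R , 0<R , R≤39 , k≡ = positive-remainder k 1≤k
  in subst (FormulaWithBound factor residue) k≡ (construct j R residue 0<R (residue-bound R≤39))
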